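{- Let $(P_n,\beta)$ be the edge-labeled path graph with vertices $v_1,\dots,v_n$ (in this order along the path), module $m_j\mathbb{Z}$ at $v_j$ and module $\mathbb{Z}/r_k\mathbb{Z}$ at the edge $v_kv_{k+1}$, where $m_1,\dots,m_n$ and $r_1,\dots,r_{n-1}$ are arbitrary integers. Then there exists a flow-up class $F^{(i)}=(0,\dots,0,f^{(i)}_{v_i},\dots,f^{(i)}_{v_n})$ on $(P_n,\beta)$ with first nonzero entry $$[m_i,r_{i-1},(m_{i+1},r_i),(m_{i+2},r_i,r_{i+1}),\dots,(m_n,r_i,r_{i+1},\dots,r_{n-1})]$$ for $i=1,2,\dots,n$. For $i=1$, we set $r_0=1$.
   Context: Notation: $(\ )$ denotes the greatest common divisor and $[\ ]$ the least common multiple of integers. A spline on $(P_n,\beta)$ is a tuple $(f_{v_1},\dots,f_{v_n})$ of integers with $f_{v_j}\in m_j\mathbb{Z}$ for all $j$ and $f_{v_k}\equiv f_{v_{k+1}}\pmod{r_k}$ for $k=1,\dots,n-1$. An $i$-th flow-up class is a spline $F^{(i)}$ with $f^{(i)}_{v_i}\neq0$ and $f^{(i)}_{v_s}=0$ for all $s<i$.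
   Formalization: The displayed least common multiple is assumed to be nonzero; for arbitrary integer labels it can be 0 (for example n = 1, m_1 = 0), and then no flow-up class with that first nonzero entry exists. -}

module Defs where

open import Data.Nat.Base using (ℕ; suc)
open import Data.Integer.Base using (ℤ; 0ℤ; 1ℤ; _-_)
open import Data.Integer.GCD using (gcd)
open import Data.Integer.LCM using (lcm)
open import Data.Integer.Divisibility.Signed using (_∣_)
open import Data.Fin.Base using (Fin; zero; suc; inject₁; toℕ; _<_)
open import Data.Fin.Properties using (_<?_)
import Data.Nat.Properties as ℕₚ
open import Data.List.Base using (List; []; _∷_; map; filter; foldr; allFin)
open import Data.Vec.Functional using (Vector)
open import Relation.Nullary.Decidable using (_×-dec_)
open import Relation.Binary.PropositionalEquality using (_≡_; _≢_)

-- The path with suc N vertices, numbered from 0; the edge k : Fin N joins the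
-- vertices inject₁ k and suc k. The modules at vertices and edges are m j ℤ
-- and ℤ / r k ℤ; labels may be zero or negative.
record LabeledPath (N : ℕ) : Set where
  field
    m : Vector ℤ (suc N)
    r : Vector ℤ N

-- Divisibility is the signed one: a ∣ x says that x = q * a for some integer
-- q, i.e. x ∈ a ℤ, also when a = 0.
record IsSpline {N : ℕ} (P : LabeledPath N) (f : Vector ℤ (suc N)) : Set where
  open LabeledPath P
  field
    vertex : ∀ (j : Fin (suc N)) → m j ∣ f j
    edge   : ∀ (k : Fin N) → r k ∣ f (inject₁ k) - f (suc k)

record IsFlowUp {N : ℕ} (P : LabeledPath N) (i : Fin (suc N))
                (f : Vector ℤ (suc N)) : Set where
  field
    spline   : IsSpline P f
    nonzero  : f i ≢ 0ℤ
    vanishes : ∀ (s : Fin (suc N)) → s < i → f s ≡ 0ℤ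

-- The library's gcd and lcm on ℤ are the nonnegative ones, with gcd 0 0 = 0
-- and lcm x 0 = 0; so 0 and 1 are their units up to sign.
gcds : List ℤ → ℤ
gcds = foldr gcd 0ℤ

lcms : List ℤ → ℤ
lcms = foldr lcm 1ℤ

verticesAfter : ∀ {N} → Fin (suc N) → List (Fin (suc N))
verticesAfter {N} i = filter (i <?_) (allFin (suc N))

-- For i < j these are the edges of the subpath from vertex i to vertex j.
edgesBetween : ∀ {N} → Fin (suc N) → Fin (suc N) → List (Fin N)
edgesBetween {N} i j =
  filter (λ k → (toℕ i ℕₚ.≤? toℕ k) ×-dec (toℕ k ℕₚ.<? toℕ j)) (allFin N)

module _ {N : ℕ} (P : LabeledPath N) where
  open LabeledPath P

  -- The label of the edge entering vertex i from the left, with the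
  -- convention that it is 1 at the first vertex.
  incomingEdge : Fin (suc N) → ℤ
  incomingEdge zero    = 1ℤ
  incomingEdge (suc k) = r k

  -- [ mᵢ , rᵢ₋₁ , (mᵢ₊₁ , rᵢ) , (mᵢ₊₂ , rᵢ , rᵢ₊₁) , … , (mₙ , rᵢ , … , rₙ₋₁) ]
  leadingEntry : Fin (suc N) → ℤ
  leadingEntry i =
    lcms (m i ∷ incomingEdge i ∷
          map (λ j → gcds (m j ∷ map r (edgesBetween i j))) (verticesAfter i))

{-# OPTIONS --safe #-}

-- The entries after the i-th are chosen greedily along the path. Say that x is
-- admissible at v_i if every (m_j , r_i , … , r_{j-1}) with j ≥ i divides it.
-- Given such an x, each congruence y ≡ x (mod r_i) has a solution divisible by
-- (m_j , r_{i+1} , … , r_{j-1}), by Bézout. Solutions y₁ and y₂ of the same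
-- congruence can be merged into one that is a multiple of both: with
-- g = (y₁ , y₂) = u y₁ + v y₂, it is u (y₁/g) y₂ + v (y₂/g) y₁. Merging over all
-- j > i yields a value admissible at v_{i+1}.
module Submission where

open import Data.Nat.Base as ℕ using (ℕ; suc; z≤n; s≤s; z<s; s<s; s≤s⁻¹; s<s⁻¹)
open import Data.Nat.Divisibility using (1∣_)
open import Data.Nat.GCD as ℕ using (module Bézout)
import Data.Nat.Properties as ℕₚ
open import Data.Integer.Base as ℤ
  using (ℤ; 0ℤ; 1ℤ; +_; -_; _+_; _-_; _*_; ≢-nonZero)
open import Data.Integer.Divisibility.Signed
open import Data.Integer.GCD using (gcd; gcd[i,j]∣i; gcd[i,j]∣j; gcd-greatest;
  gcd[i,j]≡0⇒i≡0)
open import Data.Integer.LCM using (i∣lcm[i,j]; j∣lcm[i,j])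
open import Data.Integer.Properties using (_≟_; *-cancelʳ-≡; *-assoc; *-identityˡ;
  +-comm; +-inverseʳ; pos-*)
open import Data.Integer.Tactic.RingSolver using (solve-∀)
open import Data.Fin.Base using (Fin; zero; suc; toℕ; _≤_; _<_)
open import Data.Fin.Properties using (_<?_; toℕ-injective)
open import Data.List.Base using (List; []; _∷_; map; allFin)
open import Data.List.Membership.Propositional using (_∈_)
open import Data.List.Membership.Propositional.Properties
  using (∈-map⁺; ∈-map⁻; ∈-filter⁺; ∈-filter⁻; ∈-allFin)
open import Data.List.Relation.Unary.Any using (here; there)
open import Data.Product.Base using (Σ-syntax; ∃; ∃₂; _×_; _,_)
open import Data.Sum.Base using (inj₁; inj₂)
open import Data.Vec.Functional using (Vector) renaming (_∷_ to _◂_)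
open import Function.Base using (_∘_; const; case_of_)
open import Relation.Nullary.Decidable using (Dec; yes; no; _×-dec_)
open import Relation.Binary.PropositionalEquality
  using (_≡_; _≢_; refl; sym; trans; cong; cong₂; subst; module ≡-Reasoning)
open import Defs

-- Divisibility and Bézout coefficients in ℤ.

∣0 : ∀ d → d ∣ 0ℤ
∣0 d = divides 0ℤ refl

-- Bézout over the naturals is subtraction-free and has two sign cases; both reduce to this
-- equation, the second with `m` and `n` exchanged.
+d≡xm-yn : ∀ d m n x y → d ℕ.+ y ℕ.* n ≡ x ℕ.* m →
           + d ≡ + x * + m + - (+ y) * + n
+d≡xm-yn d m n x y eq = begin
  + d                                     ≡⟨ identity (+ d) (+ y) (+ n) ⟩
  (+ d + + y * + n) + - (+ y) * + n       ≡⟨ cong (λ z → (+ d + z) + - (+ y) * + n) (pos-* y n) ⟨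
  + (d ℕ.+ y ℕ.* n) + - (+ y) * + n       ≡⟨ cong (λ z → + z + - (+ y) * + n) eq ⟩
  + (x ℕ.* m) + - (+ y) * + n             ≡⟨ cong (_+ - (+ y) * + n) (pos-* x m) ⟩
  + x * + m + - (+ y) * + n               ∎
  where
  open ≡-Reasoning
  identity : ∀ d y n → d ≡ (d + y * n) + - y * n
  identity = solve-∀

bézout-abs : ∀ m n → ∃₂ λ u v → + ℕ.gcd m n ≡ u * + m + v * + n
bézout-abs m n with Bézout.identity (ℕ.gcd-GCD m n)
... | Bézout.+- x y eq = + x , - (+ y) , +d≡xm-yn _ m n x y eq
... | Bézout.-+ x y eq = - (+ x) , + y ,
  trans (+d≡xm-yn _ n m y x eq) (+-comm (+ y * + n) (- (+ x) * + m))

bézout : ∀ i j → ∃₂ λ u v → gcd i j ≡ u * i + v * j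
-- The absolute values are multiples `s * i` and `t * j`, so the signs go into the coefficients.
bézout i j with bézout-abs ℤ.∣ i ∣ ℤ.∣ j ∣ | m∣∣m∣ {i} | m∣∣m∣ {j}
... | u , v , eq | divides s ∣i∣≡si | divides t ∣j∣≡tj = u * s , v * t , (begin
  gcd i j                          ≡⟨ eq ⟩
  u * + ℤ.∣ i ∣ + v * + ℤ.∣ j ∣    ≡⟨ cong₂ (λ a b → u * a + v * b) ∣i∣≡si ∣j∣≡tj ⟩
  u * (s * i) + v * (t * j)        ≡⟨ assoc u v s t i j ⟩
  u * s * i + v * t * j            ∎)
  where
  open ≡-Reasoning
  assoc : ∀ u v s t i j → u * (s * i) + v * (t * j) ≡ u * s * i + v * t * j
  assoc = solve-∀

-- Multiples within a residue class.

linear-combination⇒congruent-multiple : ∀ {r a x g} u v →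
  g ≡ u * r + v * a → g ∣ x → ∃ λ y → a ∣ y × r ∣ x - y
linear-combination⇒congruent-multiple {r} {a} u v refl (divides q refl) =
  -- Here `x` is `q * u * r + q * v * a`: the second summand is the witness, the first the
  -- difference.
  q * v * a , divides (q * v) refl , divides (q * u) (identity q u v r a)
  where
  identity : ∀ q u v r a → q * (u * r + v * a) - q * v * a ≡ q * u * r
  identity = solve-∀

gcd∣⇒congruent-multiple : ∀ {r a x} → gcd r a ∣ x → ∃ λ y → a ∣ y × r ∣ x - y
gcd∣⇒congruent-multiple {r} {a} g∣x = let u , v , g≡ur+va = bézout r a in
  linear-combination⇒congruent-multiple u v g≡ur+va g∣x

CongruentCommonMultiple : (r x y₁ y₂ : ℤ) → Set
CongruentCommonMultiple r x y₁ y₂ = ∃ λ y → y₁ ∣ y × y₂ ∣ y × r ∣ x - y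

-- The coefficients `u * a` and `v * b` sum to 1, so `y` stays in the residue class of `x`. Both
-- summands of `y` are multiples of `a * y₂ ≡ b * y₁`, a common multiple of `y₁` and `y₂`.
merge-bézout : ∀ {r x y₁ y₂ g} u v → g ≢ 0ℤ → g ∣ y₁ → g ∣ y₂ → g ≡ u * y₁ + v * y₂ →
               r ∣ x - y₁ → r ∣ x - y₂ → CongruentCommonMultiple r x y₁ y₂
merge-bézout {r} {x} {y₁} {y₂} {g} u v
             g≢0 (divides a y₁≡ag) (divides b y₂≡bg) g≡uy₁+vy₂ r∣x-y₁ r∣x-y₂ =
  y , divides ((u + v) * b) y≡[u+v]by₁ , divides ((u + v) * a) y≡[u+v]ay₂ ,
  subst (r ∣_) (sym x-y≡) (∣m∣n⇒∣m+n (∣n⇒∣m*n (u * a) r∣x-y₂) (∣n⇒∣m*n (v * b) r∣x-y₁))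
  where
  open ≡-Reasoning
  instance _ = ≢-nonZero g≢0
  y = u * a * y₂ + v * b * y₁

  ua+vb≡1 : u * a + v * b ≡ 1ℤ
  ua+vb≡1 = *-cancelʳ-≡ (u * a + v * b) 1ℤ g (begin
    (u * a + v * b) * g        ≡⟨ identity u a v b g ⟩
    u * (a * g) + v * (b * g)  ≡⟨ cong₂ (λ s t → u * s + v * t) y₁≡ag y₂≡bg ⟨
    u * y₁ + v * y₂            ≡⟨ g≡uy₁+vy₂ ⟨
    g                          ≡⟨ *-identityˡ g ⟨
    1ℤ * g                     ∎)
    where
    identity : ∀ u a v b g → (u * a + v * b) * g ≡ u * (a * g) + v * (b * g)
    identity = solve-∀

  ay₂≡by₁ : a * y₂ ≡ b * y₁
  ay₂≡by₁ = begin
    a * y₂       ≡⟨ cong (a *_) y₂≡bg ⟩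
    a * (b * g)  ≡⟨ identity a b g ⟩
    b * (a * g)  ≡⟨ cong (b *_) y₁≡ag ⟨
    b * y₁       ∎
    where
    identity : ∀ a b g → a * (b * g) ≡ b * (a * g)
    identity = solve-∀

  y≡[u+v]ay₂ : y ≡ (u + v) * a * y₂
  y≡[u+v]ay₂ = begin
    u * a * y₂ + v * b * y₁      ≡⟨ cong (_+_ (u * a * y₂)) (*-assoc v b y₁) ⟩
    u * a * y₂ + v * (b * y₁)    ≡⟨ cong (λ z → u * a * y₂ + v * z) ay₂≡by₁ ⟨
    u * a * y₂ + v * (a * y₂)    ≡⟨ factor u a y₂ v ⟩
    (u + v) * a * y₂             ∎
    where
    factor : ∀ u a s v → u * a * s + v * (a * s) ≡ (u + v) * a * s
    factor = solve-∀

  y≡[u+v]by₁ : y ≡ (u + v) * b * y₁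
  y≡[u+v]by₁ = begin
    y                    ≡⟨ y≡[u+v]ay₂ ⟩
    (u + v) * a * y₂     ≡⟨ *-assoc (u + v) a y₂ ⟩
    (u + v) * (a * y₂)   ≡⟨ cong ((u + v) *_) ay₂≡by₁ ⟩
    (u + v) * (b * y₁)   ≡⟨ *-assoc (u + v) b y₁ ⟨
    (u + v) * b * y₁     ∎

  x-y≡ : x - y ≡ u * a * (x - y₂) + v * b * (x - y₁)
  x-y≡ = begin
    x - y                                   ≡⟨ cong (_- y) (*-identityˡ x) ⟨
    1ℤ * x - y                              ≡⟨ cong (λ z → z * x - y) ua+vb≡1 ⟨
    (u * a + v * b) * x - y                 ≡⟨ identity (u * a) (v * b) x y₁ y₂ ⟩
    u * a * (x - y₂) + v * b * (x - y₁)     ∎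
    where
    identity : ∀ s t x y₁ y₂ →
               (s + t) * x - (s * y₂ + t * y₁) ≡ s * (x - y₂) + t * (x - y₁)
    identity = solve-∀

merge : ∀ {r x} y₁ y₂ → r ∣ x - y₁ → r ∣ x - y₂ → CongruentCommonMultiple r x y₁ y₂
merge {r} {x} y₁ y₂ r∣x-y₁ r∣x-y₂ = case gcd y₁ y₂ ≟ 0ℤ of λ where
  -- A zero gcd cannot be cancelled, but it forces `y₁` to be 0, a multiple of any `y₂`.
  (yes g≡0) → y₁ , ∣-refl ,
    subst (y₂ ∣_) (sym (gcd[i,j]≡0⇒i≡0 y₁ y₂ g≡0)) (∣0 y₂) , r∣x-y₁
  (no g≢0) → let u , v , g≡uy₁+vy₂ = bézout y₁ y₂ in
    merge-bézout {r} {x} u v g≢0 (∣ᵤ⇒∣ (gcd[i,j]∣i y₁ y₂)) (∣ᵤ⇒∣ (gcd[i,j]∣j y₁ y₂))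
                 g≡uy₁+vy₂ r∣x-y₁ r∣x-y₂

-- A Chinese remainder statement without coprimality: the residues modulo the `a j` are all 0, hence
-- mutually compatible, and only compatibility with `x` modulo `r` has to be assumed.
gcds∣⇒common-congruent-multiple :
  ∀ n {r x} (a : Vector ℤ n) → (∀ j → gcd r (a j) ∣ x) →
  ∃ λ y → (∀ j → a j ∣ y) × r ∣ x - y
gcds∣⇒common-congruent-multiple ℕ.zero {r} {x} a gcd∣x =
  x , (λ ()) , subst (r ∣_) (sym (+-inverseʳ x)) (∣0 r)
gcds∣⇒common-congruent-multiple (suc n) {r} {x} a gcd∣x =
  let y₁ , a₀∣y₁ , r∣x-y₁       = gcd∣⇒congruent-multiple {r} {a zero} {x} (gcd∣x zero)
      y₂ , a∣y₂ , r∣x-y₂        = gcds∣⇒common-congruent-multiple n {r} {x} (a ∘ suc) (gcd∣x ∘ suc)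
      y , y₁∣y , y₂∣y , r∣x-y   = merge {r} {x} y₁ y₂ r∣x-y₁ r∣x-y₂
  in y , (λ { zero → ∣-trans a₀∣y₁ y₁∣y ; (suc j) → ∣-trans (a∣y₂ j) y₂∣y }) , r∣x-y

-- Universal properties of iterated gcds and lcms.

gcds∣ : ∀ {x xs} → x ∈ xs → gcds xs ∣ x
gcds∣ {xs = y ∷ ys} (here refl) = ∣ᵤ⇒∣ (gcd[i,j]∣i y (gcds ys))
gcds∣ {xs = y ∷ ys} (there x∈)  =
  ∣-trans (∣ᵤ⇒∣ (gcd[i,j]∣j y (gcds ys))) (gcds∣ x∈)

gcds-greatest : ∀ {d} xs → (∀ {x} → x ∈ xs → d ∣ x) → d ∣ gcds xs
gcds-greatest {d} []   d∣ = ∣0 d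
gcds-greatest {d} (x ∷ xs) d∣ =
  ∣ᵤ⇒∣ (gcd-greatest {x} {gcds xs} {d} (∣⇒∣ᵤ (d∣ (here refl)))
                     (∣⇒∣ᵤ (gcds-greatest xs (d∣ ∘ there))))

∣lcms : ∀ {x xs} → x ∈ xs → x ∣ lcms xs
∣lcms {xs = y ∷ ys} (here refl) = ∣ᵤ⇒∣ (i∣lcm[i,j] y (lcms ys))
∣lcms {xs = y ∷ ys} (there x∈)  =
  ∣-trans (∣lcms x∈) (∣ᵤ⇒∣ (j∣lcm[i,j] y (lcms ys)))

-- Gcds along subpaths.

module _ {N : ℕ} (P : LabeledPath N) (i j : Fin (suc N)) where
  open LabeledPath P

  -- For `i ≤ j` this divides the value at `i` of every spline: the value at `j` is a multiple of
  -- `m j`, and the edges between carry the congruence back. For `j ≤ i` no edge is collected, which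
  -- leaves `m j` up to sign.
  subpathGcd : ℤ
  subpathGcd = gcds (m j ∷ map r (edgesBetween i j))

  private
    between? : ∀ (k : Fin N) → Dec (toℕ i ℕ.≤ toℕ k × toℕ k ℕ.< toℕ j)
    between? k = (toℕ i ℕₚ.≤? toℕ k) ×-dec (toℕ k ℕₚ.<? toℕ j)

  subpathGcd∣m : subpathGcd ∣ m j
  subpathGcd∣m = gcds∣ {xs = m j ∷ map r (edgesBetween i j)} (here refl)

  subpathGcd∣r : ∀ k → toℕ i ℕ.≤ toℕ k → toℕ k ℕ.< toℕ j → subpathGcd ∣ r k
  subpathGcd∣r k i≤k k<j =
    gcds∣ {xs = m j ∷ map r (edgesBetween i j)}
          (there (∈-map⁺ r (∈-filter⁺ between? (∈-allFin k) (i≤k , k<j))))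

  subpathGcd-greatest : ∀ {d} → d ∣ m j →
    (∀ k → toℕ i ℕ.≤ toℕ k → toℕ k ℕ.< toℕ j → d ∣ r k) → d ∣ subpathGcd
  subpathGcd-greatest {d} d∣m d∣r = gcds-greatest _ d∣
    where
    d∣ : ∀ {x} → x ∈ m j ∷ map r (edgesBetween i j) → d ∣ x
    d∣ (here refl) = d∣m
    d∣ (there x∈) with ∈-map⁻ r x∈
    ... | k , k∈ , refl =
      let _ , i≤k , k<j = ∈-filter⁻ between? {xs = allFin N} k∈ in d∣r k i≤k k<j

-- Removing and restoring the first vertex.

tail : ∀ {N} → LabeledPath (suc N) → LabeledPath N
tail P = record { m = m ∘ suc ; r = r ∘ suc }
  where open LabeledPath P

module _ {N : ℕ} (P : LabeledPath (suc N)) where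
  open LabeledPath P

  subpathGcd-tail : ∀ i j → subpathGcd (tail P) i j ∣ subpathGcd P (suc i) (suc j)
  subpathGcd-tail i j = subpathGcd-greatest P (suc i) (suc j) (subpathGcd∣m (tail P) i j)
    λ { (suc k) i≤k k<j → subpathGcd∣r (tail P) i j k (s≤s⁻¹ i≤k) (s<s⁻¹ k<j) }

  -- The subpath from the first vertex is edge `zero` followed by a subpath of the tail. This turns
  -- admissibility at the first vertex into solvability of the congruences modulo `r zero`.
  gcd-subpathGcd-tail : ∀ j →
    gcd (r zero) (subpathGcd (tail P) zero j) ∣ subpathGcd P zero (suc j)
  gcd-subpathGcd-tail j = subpathGcd-greatest P zero (suc j)
    (∣-trans g∣tail (subpathGcd∣m (tail P) zero j))
    λ { zero    _ _   → ∣ᵤ⇒∣ (gcd[i,j]∣i (r zero) (subpathGcd (tail P) zero j))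
      ; (suc k) _ k<j → ∣-trans g∣tail (subpathGcd∣r (tail P) zero j k z≤n (s<s⁻¹ k<j)) }
    where
    g∣tail : gcd (r zero) (subpathGcd (tail P) zero j) ∣ subpathGcd (tail P) zero j
    g∣tail = ∣ᵤ⇒∣ (gcd[i,j]∣j (r zero) (subpathGcd (tail P) zero j))

  cons-isSpline : ∀ {x f} → m zero ∣ x → r zero ∣ x - f zero →
                  IsSpline (tail P) f → IsSpline P (x ◂ f)
  cons-isSpline m∣x r∣x-f₀ f-spline = record
    { vertex = λ { zero → m∣x ; (suc j) → vertex j }
    ; edge   = λ { zero → r∣x-f₀ ; (suc k) → edge k }
    }
    where open IsSpline f-spline

-- Construction of splines and flow-up classes.

m∣admissible : ∀ {N} (P : LabeledPath N) {x} → subpathGcd P zero zero ∣ x →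
               LabeledPath.m P zero ∣ x
-- The subpath from a vertex to itself has no edges.
m∣admissible P = ∣-trans (subpathGcd-greatest P zero zero ∣-refl (λ _ _ ()))

spline-from : ∀ {N} (P : LabeledPath N) x → (∀ j → subpathGcd P zero j ∣ x) →
              Σ[ F ∈ Vector ℤ (suc N) ] IsSpline P F × F zero ≡ x
spline-from {ℕ.zero} P x adm =
  const x , record { vertex = λ { zero → m∣admissible P (adm zero) } ; edge = λ () } , refl
spline-from {suc N} P x adm =
  let r₀ = LabeledPath.r P zero
      -- The moduli run over all vertices of the tail, so `y` is admissible at its first vertex and
      -- the recursion continues.
      y , adm-y , r₀∣x-y = gcds∣⇒common-congruent-multiple (suc N) {r₀} {x} (subpathGcd (tail P) zero)
        (λ j → ∣-trans (gcd-subpathGcd-tail P j) (adm (suc j)))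
      F , F-spline , F₀≡y = spline-from (tail P) y adm-y
      r₀∣x-F₀ = subst (λ z → r₀ ∣ x - z) (sym F₀≡y) r₀∣x-y
  in x ◂ F , cons-isSpline P {x} (m∣admissible P (adm zero)) r₀∣x-F₀ F-spline , refl

-- If `i` is `zero`, passing to the tail replaces the label `r zero` by the conventional 1; the
-- condition lost here is recovered by `first-edge∣`.
incomingEdge-tail : ∀ {N} (P : LabeledPath (suc N)) i {x} →
                    incomingEdge P (suc i) ∣ x → incomingEdge (tail P) i ∣ x
incomingEdge-tail P zero    _   = ∣ᵤ⇒∣ (1∣ _)
incomingEdge-tail P (suc _) r∣x = r∣x

-- Edge `zero` either enters the leading vertex, where its label divides the leading entry, or is
-- followed by a vertex of value 0.
first-edge∣ : ∀ {N} (P : LabeledPath (suc N)) i {F : Vector ℤ (suc N)} →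
              incomingEdge P (suc i) ∣ F i → (∀ s → s < i → F s ≡ 0ℤ) →
              LabeledPath.r P zero ∣ F zero
first-edge∣ P zero    r∣Fᵢ _        = r∣Fᵢ
first-edge∣ P (suc _) _    vanishes = subst (_ ∣_) (sym (vanishes zero z<s)) (∣0 _)

-- The bound `i ≤ j` matters: vertices before `i` receive 0, which satisfies their conditions
-- without constraining `x`, while their `subpathGcd` need not divide `x`.
flowUp-from : ∀ {N} (P : LabeledPath N) i x → incomingEdge P i ∣ x →
              (∀ j → i ≤ j → subpathGcd P i j ∣ x) →
              Σ[ F ∈ Vector ℤ (suc N) ]
                IsSpline P F × (∀ s → s < i → F s ≡ 0ℤ) × F i ≡ x
flowUp-from P zero x _ adm =
  let F , F-spline , F₀≡x = spline-from P x (λ j → adm j z≤n)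
  in F , F-spline , (λ _ ()) , F₀≡x
flowUp-from {suc N} P (suc i) x r∣x adm =
  let F , F-spline , vanishes , Fᵢ≡x =
        flowUp-from (tail P) i x (incomingEdge-tail P i r∣x)
          (λ j i≤j → ∣-trans (subpathGcd-tail P i j) (adm (suc j) (s≤s i≤j)))
      r₀∣F₀ = first-edge∣ P i {F} (subst (incomingEdge P (suc i) ∣_) (sym Fᵢ≡x) r∣x) vanishes
  in 0ℤ ◂ F ,
     cons-isSpline P {0ℤ} (∣0 _) (∣m∣n⇒∣m-n {m = 0ℤ} (∣0 _) r₀∣F₀) F-spline ,
     (λ { zero _ → refl ; (suc s) s<i → vanishes s (s<s⁻¹ s<i) }) ,
     Fᵢ≡x

-- An lcm with a zero argument is 0 and cannot be a first nonzero entry, hence the hypothesis.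
theorem5p3 : ∀ (N : ℕ) (P : LabeledPath N) (i : Fin (suc N)) → leadingEntry P i ≢ 0ℤ → Σ[ F ∈ Vector ℤ (suc N) ] (IsFlowUp P i F × F i ≡ leadingEntry P i)
theorem5p3 N P i x≢0 =
  let F , F-spline , vanishes , Fᵢ≡x =
        flowUp-from P i (leadingEntry P i) (∣lcms {xs = entries} (there (here refl))) admissible
  in F , record { spline = F-spline ; nonzero = x≢0 ∘ trans (sym Fᵢ≡x) ; vanishes = vanishes } , Fᵢ≡x
  where
  entries : List ℤ
  entries = LabeledPath.m P i ∷ incomingEdge P i ∷ map (subpathGcd P i) (verticesAfter i)

  admissible : ∀ j → i ≤ j → subpathGcd P i j ∣ leadingEntry P i
  admissible j i≤j with ℕₚ.m≤n⇒m<n∨m≡n i≤j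
  ... | inj₁ i<j = ∣lcms {xs = entries} (there (there
        (∈-map⁺ (subpathGcd P i) (∈-filter⁺ (i <?_) (∈-allFin j) i<j))))
  -- For `j` equal to `i` the gcd is not listed separately, but it divides the listed `m i`.
  ... | inj₂ i≡j with refl ← toℕ-injective i≡j =
        ∣-trans (subpathGcd∣m P i i) (∣lcms {xs = entries} (here refl))
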